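{- (1) If $A\in C_1$ and $a\in A\setminus E_1$, then $\bar d(A)\le \frac{a-1}{2a}$. (2) If $A\in C_2$ and $a\in A\setminus E_2$, then $\bar d(A)\le \frac{4a-2}{6a}$. (3) If $A\in C_3$ and $a\in A\setminus E_3$, then $\bar d(A)\le \frac{22a-4}{30a}$.
   Context: Let $\mathbb{Z}^{+}$ be the set of positive integers and $p_i$ the $i$th prime. $C_k$ is the family of all subsets $A\subseteq\mathbb{Z}^{+}$ that do not contain $k+1$ pairwise coprime integers. $E_k$ is the set of positive integers divisible by at least one of $p_1,\ldots,p_k$. For $A\subseteq\mathbb{Z}^{+}$, $A(n)=A\cap\{1,\ldots,n\}$, $|A(n)|$ is its number of elements, and the upper density is $\bar d(A)=\limsup_{n\to\infty}|A(n)|/n$.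
   Formalization: Parts (2) and (3) are proved for a ≠ 1, since they fail for a = 1: {1}∪E_1 lies in C_2 with density 1/2 > 1/3, and {1}∪E_2 lies in C_3 with density 2/3 > 3/5. Membership in A is taken to be decidable, which is automatic classically. -}

module Defs where

open import Data.Integer.Base using (+_)
open import Data.List.Base using (List; length; filter; applyUpTo)
open import Data.List.Relation.Unary.All using (All)
open import Data.List.Relation.Unary.AllPairs using (AllPairs)
open import Data.List.Relation.Unary.Unique.Propositional using (Unique)
open import Data.Nat.Base as ℕ using (ℕ; suc; NonZero)
open import Data.Nat.Coprimality using (Coprime)
open import Data.Nat.Divisibility using (_∣_)
open import Data.Nat.Primality using (Prime; prime?)
open import Data.Product.Base using (_×_; ∃-syntax)
open import Data.Rational.Base using (ℚ; _/_; _≤_; _<_)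
open import Level using (0ℓ)
open import Relation.Binary.PropositionalEquality.Core using (_≡_)
open import Relation.Nullary.Negation.Core using (¬_)
open import Relation.Unary using (Pred; Decidable; _∈_; _⊆_)

ℤ⁺ : Pred ℕ 0ℓ
ℤ⁺ n = 0 ℕ.< n

-- |A(n)|; decidability of A (automatic classically) makes it a numeral.
∣_⟨_⟩∣ : {A : Pred ℕ 0ℓ} → Decidable A → ℕ → ℕ
∣ A? ⟨ n ⟩∣ = length (filter A? (applyUpTo suc n))

-- p is the i-th prime (counting from p₁ = 2): it is prime and exactly i primes
-- lie in {1, …, p}.
IsNthPrime : ℕ → ℕ → Set
IsNthPrime i p = Prime p × ∣ prime? ⟨ p ⟩∣ ≡ i

E : ℕ → Pred ℕ 0ℓ
E k n = n ∈ ℤ⁺ × ∃[ i ] ∃[ p ] (1 ℕ.≤ i × i ℕ.≤ k × IsNthPrime i p × p ∣ n)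

-- The k + 1 integers are distinct, so 1 (which is coprime to itself) counts
-- only once: for example, {1} belongs to C 1.
C : ℕ → Pred (Pred ℕ 0ℓ) 0ℓ
C k A = A ⊆ ℤ⁺ ×
  ¬ (∃[ xs ] (length xs ≡ suc k × Unique xs × All A xs × AllPairs Coprime xs))

EventuallyBoundedBy : ((n : ℕ) .{{_ : NonZero n}} → ℚ) → Pred ℚ 0ℓ
EventuallyBoundedBy u r = ∃[ N ] (∀ n .{{_ : NonZero n}} → N ℕ.≤ n → u n ≤ r)

-- limsup u is the infimum of the eventual upper bounds of u.  That set is
-- upward closed, so its infimum is at most q iff it contains every r > q.
limsup_≤_ : ((n : ℕ) .{{_ : NonZero n}} → ℚ) → ℚ → Set
limsup u ≤ q = ∀ r → q < r → EventuallyBoundedBy u r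

upperDensity_≤_ : {A : Pred ℕ 0ℓ} → Decidable A → ℚ → Set
upperDensity A? ≤ q = limsup (λ n → + ∣ A? ⟨ n ⟩∣ / n) ≤ q

{-# OPTIONS --safe #-}

-- Cut ℕ into blocks of M = 2, 6, 30 consecutive integers for k = 1, 2, 3.  Two
-- positions of a block whose difference has no prime factor outside M, and which
-- share no prime factor with M, hold coprime integers in every block.  A short
-- search shows that a set containing no (k + 1)-clique of this graph leaves
-- out at least m = 1, 2, 8 positions.  If moreover a divides tM + z, then a is
-- coprime to every tM + j for which z - j has no prime factor outside M, so a
-- forbids k-cliques among these j as well; for suitable z (the lists zs: one, two
-- and four of them) the same search shows that block t misses m + 1 positions.
-- By the Chinese remainder theorem each z occurs exactly once in a consecutive
-- blocks, and for different z in different blocks, so every period of M a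
-- integers misses at least m a + |zs| of them.

module Submission where

open import Defs
open import Data.Bool.Base using (Bool; true; false; T; _∧_; if_then_else_)
open import Data.Bool.Properties using (T-∧)
open import Data.Integer.Base as ℤ using (+_; _-_; _*_)
import Data.Integer.Properties as ℤₚ
open import Data.List.Base using (List; []; _∷_; _++_; map; filter; length; upTo; applyUpTo)
open import Data.List.Membership.DecPropositional using () renaming (_∈?_ to member?)
import Data.List.Membership.Propositional as List
open import Data.List.Properties using (length-map)
open import Data.List.Relation.Unary.All as All using (All; []; _∷_)
import Data.List.Relation.Unary.All.Properties as Allₚ
open import Data.List.Relation.Unary.AllPairs as AllPairs using (AllPairs; []; _∷_)
import Data.List.Relation.Unary.AllPairs.Properties as AllPairsₚ
open import Data.List.Relation.Unary.Any as Any using (Any; here; there)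
import Data.List.Relation.Unary.Any.Properties as Anyₚ
open import Data.List.Relation.Unary.Unique.Propositional using (Unique)
open import Data.Nat.Base as ℕ
  using (ℕ; zero; suc; NonZero; _+_; _∸_; _^_; _≤_; _<_; z≤n; s≤s; ∣_-_∣; _≡ᵇ_)
open import Data.Nat.Coprimality using (Coprime; coprime-Bézout; coprime-divisor)
open import Data.Nat.Divisibility
open import Data.Nat.DivMod using (_%_; m≡m%n+[m/n]*n; m%n<n; m/n*n≤m)
open import Data.Nat.GCD using (gcd; gcd-greatest; module Bézout)
open import Data.Nat.ListAction using (sum)
open import Data.Nat.Primality using (prime?; prime⇒irreducible)
open import Data.Nat.Properties
open import Data.Nat.Tactic.RingSolver using (solve-∀)
open import Data.Product.Base using (_×_; _,_; proj₁; proj₂; ∃-syntax; map₂)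
open import Data.Rational.Base as ℚ using (mkℚ; _/_)
import Data.Rational.Properties as ℚₚ
import Data.Rational.Unnormalised.Base as ℚᵘ
import Data.Rational.Unnormalised.Properties as ℚᵘₚ
open import Data.Sum.Base using (inj₁; inj₂)
open import Function.Base using (_∘_; id)
open import Function.Bundles using (Equivalence)
open import Level using (0ℓ)
open import Relation.Binary.PropositionalEquality
  using (_≡_; _≢_; refl; sym; trans; cong; cong₂; subst; subst₂; module ≡-Reasoning)
open import Relation.Nullary.Decidable using (Dec; does; yes; no; ¬?; _×-dec_; from-yes)
open import Relation.Nullary.Negation using (¬_; contradiction)
open import Relation.Unary using (Pred; Decidable; _∈_; _∉_; _∖_)

open import Algebra.Properties.CommutativeSemigroup +-commutativeSemigroup using (interchange; x∙yz≈y∙xz)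

-- Finite sums of natural numbers

∑ : ℕ → (ℕ → ℕ) → ℕ
∑ n f = sum (applyUpTo f n)

∑-cong : ∀ n {f g} → (∀ i → f i ≡ g i) → ∑ n f ≡ ∑ n g
∑-cong zero    _   = refl
∑-cong (suc n) f≡g = cong₂ _+_ (f≡g 0) (∑-cong n (f≡g ∘ suc))

∑-+ : ∀ m n f → ∑ (m + n) f ≡ ∑ m f + ∑ n (λ i → f (m + i))
∑-+ zero    n f = refl
∑-+ (suc m) n f = trans (cong (_+_ (f 0)) (∑-+ m n (f ∘ suc))) (sym (+-assoc (f 0) _ _))

∑-* : ∀ m n f → ∑ (m ℕ.* n) f ≡ ∑ m (λ i → ∑ n (λ j → f (i ℕ.* n + j)))
∑-* zero    n f = refl
∑-* (suc m) n f = begin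
  ∑ (n + m ℕ.* n) f                                          ≡⟨ ∑-+ n (m ℕ.* n) f ⟩
  ∑ n f + ∑ (m ℕ.* n) (λ i → f (n + i))                      ≡⟨ cong (_+_ (∑ n f)) (∑-* m n _) ⟩
  ∑ n f + ∑ m (λ i → ∑ n (λ j → f (n + (i ℕ.* n + j))))      ≡⟨ cong (_+_ (∑ n f))
    (∑-cong m λ i → ∑-cong n λ j → cong f (sym (+-assoc n (i ℕ.* n) j))) ⟩
  ∑ n f + ∑ m (λ i → ∑ n (λ j → f (suc i ℕ.* n + j)))        ∎
  where open ≡-Reasoning

∑-lower : ∀ n {f c} → (∀ i → c ≤ f i) → n ℕ.* c ≤ ∑ n f
∑-lower zero    _   = z≤n
∑-lower (suc n) c≤f = +-mono-≤ (c≤f 0) (∑-lower n (c≤f ∘ suc))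

∑-distrib-+ : ∀ n f g → ∑ n (λ i → f i + g i) ≡ ∑ n f + ∑ n g
∑-distrib-+ zero    f g = refl
∑-distrib-+ (suc n) f g =
  trans (cong (_+_ (f 0 + g 0)) (∑-distrib-+ n (f ∘ suc) (g ∘ suc))) (interchange (f 0) (g 0) _ _)

∑-const : ∀ n c → ∑ n (λ _ → c) ≡ n ℕ.* c
∑-const zero    c = refl
∑-const (suc n) c = cong (_+_ c) (∑-const n c)

-- With the Boolean test, `erase (suc v) f ∘ suc` unfolds to `erase v (f ∘ suc)`, on which the
-- recursion in `∑-erase` rests.
erase : ℕ → (ℕ → ℕ) → ℕ → ℕ
erase v f w = if v ≡ᵇ w then 0 else f w

erase-≢ : ∀ {v w} f → w ≢ v → erase v f w ≡ f w
erase-≢ {v} {w} f w≢v with v ≡ᵇ w in eq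
... | false = refl
... | true  = contradiction (sym (≡ᵇ⇒≡ v w (subst T (sym eq) _))) w≢v

∑-erase : ∀ {n v} f → v < n → f v + ∑ n (erase v f) ≡ ∑ n f
∑-erase {suc n} {zero}  f _         = refl
∑-erase {suc n} {suc v} f (s≤s v<n) = trans (x∙yz≈y∙xz (f (suc v)) (f 0) _)
  (cong (_+_ (f 0)) (∑-erase (f ∘ suc) v<n))

∑-erase-< : ∀ {n} v f → v < n → 0 < f v → ∑ n (erase v f) < ∑ n f
∑-erase-< {n} v f v<n 0<fv = subst (∑ n (erase v f) <_) (∑-erase f v<n) (+-monoˡ-≤ _ 0<fv)

-- Each entry accounts for one unit of the sum; erasing it leaves the values at the other entries
-- intact, as they are distinct from it.
length≤∑ : ∀ {n us} f → Unique us → All (λ u → u < n × 0 < f u) us → length us ≤ ∑ n f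
length≤∑ f []             []                  = z≤n
length≤∑ {us = u ∷ _} f (u≢us ∷ us!) ((u<n , 0<fu) ∷ hits) = <-≤-trans
  (s≤s (length≤∑ (erase u f) us! (All.zipWith
    (λ { (u≢w , w<n , 0<fw) → w<n , subst (0 <_) (sym (erase-≢ f (u≢w ∘ sym))) 0<fw }) (u≢us , hits))))
  (∑-erase-< u f u<n 0<fu)

-- Apply `length≤∑` to the excess `f i ∸ c`.
∑-lower-strict : ∀ {n us c} f → (∀ i → c ≤ f i) → Unique us → All (λ u → u < n × c < f u) us →
  n ℕ.* c + length us ≤ ∑ n f
∑-lower-strict {n} {us} {c} f c≤f us! bigger = begin
  n ℕ.* c + length us              ≤⟨ +-monoʳ-≤ (n ℕ.* c) (length≤∑ (λ i → f i ∸ c) us! (All.map (map₂ m<n⇒0<n∸m) bigger)) ⟩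
  n ℕ.* c + ∑ n (λ i → f i ∸ c)    ≡⟨ cong (_+ ∑ n (λ i → f i ∸ c)) (∑-const n c) ⟨
  ∑ n (λ _ → c) + ∑ n (λ i → f i ∸ c) ≡⟨ ∑-distrib-+ n (λ _ → c) _ ⟨
  ∑ n (λ i → c + (f i ∸ c))        ≡⟨ ∑-cong n (λ i → m+[n∸m]≡n (c≤f i)) ⟩
  ∑ n f                            ∎
  where open ≤-Reasoning

-- Lower bounds for hitting sets by search

infix 4 _∈?_
_∈?_ : ∀ v q → Dec (v List.∈ q)
_∈?_ = member? _≟_

delete : ℕ → List ℕ → List ℕ
delete v = filter (λ w → ¬? (v ≟ w))

avoiding : ℕ → List (List ℕ) → List (List ℕ)
avoiding v = filter (λ q → ¬? (v ∈? q))

mutual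
  -- The value `true` certifies that every set of vertices meeting all the lists has at least `m`
  -- elements. No set meets an empty list, hence `branch m [] qs` is `true`.
  needs : ℕ → List (List ℕ) → Bool
  needs zero    _        = true
  needs (suc m) []       = false
  needs (suc m) (q ∷ qs) = branch m q qs

  -- Branches on the first vertex of q that is chosen; the vertices before it are
  -- known not to be chosen and are deleted from the remaining sets.
  branch : ℕ → List ℕ → List (List ℕ) → Bool
  branch m []      qs = true
  branch m (v ∷ q) qs = needs m (avoiding v qs) ∧ branch m q (map (delete v) qs)

Hit : ℕ → (ℕ → ℕ) → List ℕ → Set
Hit n f = Any (λ v → v < n × 0 < f v)

hit-delete : ∀ {n f v q} → ¬ (v < n × 0 < f v) → Hit n f q → Hit n f (delete v q)
hit-delete {n} {f} {v} ¬v hit with Anyₚ.filter⁺ (λ w → ¬? (v ≟ w)) hit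
... | inj₁ hit′ = hit′
... | inj₂ ¬v≢w = contradiction
  (λ v≡w → ¬v (subst (λ w → w < n × 0 < f w) (sym v≡w) (Anyₚ.lookup-result hit))) ¬v≢w

hit-erase : ∀ {n f v} q → v List.∉ q → Hit n f q → Hit n (erase v f) q
hit-erase {f = f} (w ∷ q) v∉ (here (w<n , h)) =
  here (w<n , subst (0 <_) (sym (erase-≢ f (v∉ ∘ here ∘ sym))) h)
hit-erase (w ∷ q) v∉ (there h) = there (hit-erase q (v∉ ∘ there) h)

mutual
  -- The hitting set is the support of `f` below `n`. Choosing `v` replaces `f` by `erase v f`,
  -- which pays for one unit of `m` and keeps the lists avoiding `v` hit; a vertex outside the
  -- support can be deleted without losing a hit.
  needs-sound : ∀ {n f} m qs → T (needs m qs) → All (Hit n f) qs → m ≤ ∑ n f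
  needs-sound zero    _        _  _            = z≤n
  needs-sound (suc m) (q ∷ qs) ok (hit ∷ hits) = branch-sound m q qs ok hit hits

  branch-sound : ∀ {n f} m q qs → T (branch m q qs) → Hit n f q → All (Hit n f) qs → m < ∑ n f
  branch-sound {n} {f} m (v ∷ q) qs ok hit hits with Equivalence.to T-∧ ok | (v <? n) ×-dec (0 <? f v)
  ... | okₗ , _ | yes (v<n , 0<fv) = <-≤-trans
    (s≤s (needs-sound m (avoiding v qs) okₗ (All.zipWith (λ (v∉ , h) → hit-erase _ v∉ h)
      (Allₚ.all-filter _ qs , Allₚ.filter⁺ _ hits))))
    (∑-erase-< v f v<n 0<fv)
  ... | _ , okᵣ | no ¬v = branch-sound m q _ okᵣ (Any.tail ¬v hit)
    (Allₚ.map⁺ (All.map (hit-delete ¬v) hits))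

-- Enumeration of cliques

module _ {R : ℕ → ℕ → Set} (R? : ∀ i j → Dec (R i j)) where

  cliques : ℕ → List ℕ → List (List ℕ)
  cliques zero    _        = [] ∷ []
  cliques (suc k) []       = []
  cliques (suc k) (v ∷ vs) = map (v ∷_) (cliques k (filter (R? v) vs)) ++ cliques (suc k) vs

  -- `P` carries facts about single vertices along: lying in the block, or being close to `z` as
  -- well.
  cliques-sound : ∀ {P : Pred ℕ 0ℓ} k {vs} → All P vs →
    All (λ q → length q ≡ k × AllPairs R q × All P q) (cliques k vs)
  cliques-sound zero    _          = (refl , [] , []) ∷ []
  cliques-sound (suc k) []         = []
  cliques-sound (suc k) {v ∷ vs} (pv ∷ pvs) = Allₚ.++⁺
    (Allₚ.map⁺ (All.map
      (λ { (len , pairs , all) → cong suc len , All.map proj₁ all ∷ pairs , pv ∷ All.map proj₂ all })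
      (cliques-sound k (All.zip (Allₚ.all-filter (R? v) vs , Allₚ.filter⁺ (R? v) pvs)))))
    (cliques-sound (suc k) pvs)

-- Coprime integers within a block

∣x∣y⇒∣∣x-y∣ : ∀ {d x y} → d ∣ x → d ∣ y → d ∣ ∣ x - y ∣
∣x∣y⇒∣∣x-y∣ (divides p refl) (divides q refl) = divides ∣ p - q ∣ (sym (*-distribʳ-∣-∣ _ p q))

coprime∧∣^⇒≡1 : ∀ {d m} e → Coprime d m → d ∣ m ^ e → d ≡ 1
coprime∧∣^⇒≡1 zero    _ d∣1 = ∣1⇒≡1 d∣1
coprime∧∣^⇒≡1 (suc e) c d∣  = coprime∧∣^⇒≡1 e c (coprime-divisor c d∣)

module _ (M : ℕ) where

  -- For positions below 30, dividing M ^ 4 just means having no prime factor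
  -- outside M.
  Close : ℕ → ℕ → Set
  Close i j = ∣ i - j ∣ ∣ M ^ 4

  close? : ∀ i j → Dec (Close i j)
  close? i j = ∣ i - j ∣ ∣? M ^ 4

  Edge : ℕ → ℕ → Set
  Edge i j = gcd (gcd i j) M ≡ 1 × Close i j

  edge? : ∀ i j → Dec (Edge i j)
  edge? i j = (gcd (gcd i j) M ≟ 1) ×-dec close? i j

  blockCliques : ℕ → List (List ℕ)
  blockCliques k = cliques edge? k (upTo M)

  nearbyCliques : ℕ → ℕ → List (List ℕ)
  nearbyCliques k z = cliques edge? k (filter (close? z) (upTo M))

  ∣shifted⇒∣∣i-j∣ : ∀ {d} s {i j} → d ∣ s + i → d ∣ s + j → d ∣ ∣ i - j ∣
  ∣shifted⇒∣∣i-j∣ s d∣i d∣j = subst (_ ∣_) (∣m+n-m+o∣≡∣n-o∣ s _ _) (∣x∣y⇒∣∣x-y∣ d∣i d∣j)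

  -- A common divisor `d` divides `∣ i - j ∣`, hence `M ^ 4`. It is coprime to `M`, because whatever
  -- divides both `d` and `M` also divides `i` and `j`. So `d` is 1.
  edge⇒coprime : ∀ t {i j} → Edge i j → Coprime (t ℕ.* M + i) (t ℕ.* M + j)
  edge⇒coprime t {i} {j} (gcd≡1 , close) {d} (d∣x , d∣y) =
    coprime∧∣^⇒≡1 4 d⊥M (∣-trans (∣shifted⇒∣∣i-j∣ (t ℕ.* M) d∣x d∣y) close)
    where
    d⊥M : Coprime d M
    d⊥M (e∣d , e∣M) = ∣1⇒≡1 (subst (_ ∣_) gcd≡1 (gcd-greatest (gcd-greatest (residue d∣x) (residue d∣y)) e∣M))
      where
      residue : ∀ {k} → d ∣ t ℕ.* M + k → _ ∣ k
      residue d∣ = ∣m+n∣m⇒∣n (∣-trans e∣d d∣) (∣n⇒∣m*n t e∣M)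

  -- As for `edge⇒coprime`, except that a common divisor inherits its coprimality to `M` from `a`.
  close⇒coprime : ∀ {a} t {z j} → Coprime a M → a ∣ t ℕ.* M + z → Close z j → Coprime a (t ℕ.* M + j)
  close⇒coprime t a⊥M a∣ close (d∣a , d∣y) = coprime∧∣^⇒≡1 4
    (λ (e∣d , e∣M) → a⊥M (∣-trans e∣d d∣a , e∣M))
    (∣-trans (∣shifted⇒∣∣i-j∣ (t ℕ.* M) (∣-trans d∣a a∣) d∣y) close)

  -- `Close` excludes equal positions, since 0 does not divide `M ^ 4`.
  edge⇒≢ : .{{NonZero M}} → ∀ t {i j} → Edge i j → t ℕ.* M + i ≢ t ℕ.* M + j
  edge⇒≢ t (_ , close) eq = m<n⇒n≢0 (m^n>0 M 4)
    (0∣⇒≡0 (subst (_∣ M ^ 4) (m≡n⇒∣m-n∣≡0 (+-cancelˡ-≡ (t ℕ.* M) _ _ eq)) close))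

  -- `M` is invertible modulo `a`, so w M + z ≡ 0 has a solution, and only its residue `u` matters.
  -- The offset `z` may lie beyond the block.
  divisible-block : ∀ {a} .{{_ : NonZero a}} → Coprime a M → ∀ z → ∃[ u ] (u < a × ∀ q → a ∣ (q ℕ.* a + u) ℕ.* M + z)
  divisible-block {a@(suc a-1)} a⊥M z = w % a , m%n<n w a , λ q → ∣m+n∣m⇒∣n
    (subst (a ∣_) (shift q) (∣m∣n⇒∣m+n (n∣m*n (q ℕ.* M)) a∣w))
    (n∣m*n (w ℕ./ a ℕ.* M))
    where
    solution : ∃[ w ] a ∣ w ℕ.* M + z
    solution with coprime-Bézout a⊥M
    ... | Bézout.+- x y eq = y ℕ.* z , divides (z ℕ.* x)
      (trans (lemma y z M) (trans (cong (z ℕ.*_) eq) (sym (*-assoc z x a))))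
      where
      lemma : ∀ y z M → y ℕ.* z ℕ.* M + z ≡ z ℕ.* (1 + y ℕ.* M)
      lemma = solve-∀
    -- Here `y` inverts `M` modulo `a`, and the factor `a-1` stands in for -1.
    ... | Bézout.-+ x y eq = y ℕ.* (z ℕ.* a-1) , divides (z + z ℕ.* a-1 ℕ.* x)
      (trans (lemma₁ y z a-1 M) (trans (cong (λ v → v ℕ.* (z ℕ.* a-1) + z) (sym eq)) (lemma₂ a-1 x z)))
      where
      lemma₁ : ∀ y z b M → y ℕ.* (z ℕ.* b) ℕ.* M + z ≡ y ℕ.* M ℕ.* (z ℕ.* b) + z
      lemma₁ = solve-∀
      lemma₂ : ∀ b x z → (1 + x ℕ.* (1 + b)) ℕ.* (z ℕ.* b) + z ≡ (z + z ℕ.* b ℕ.* x) ℕ.* (1 + b)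
      lemma₂ = solve-∀
    w = proj₁ solution
    a∣w = proj₂ solution
    shift : ∀ q → q ℕ.* M ℕ.* a + (w ℕ.* M + z) ≡ w ℕ./ a ℕ.* M ℕ.* a + ((q ℕ.* a + w % a) ℕ.* M + z)
    shift q = trans (cong (λ v → q ℕ.* M ℕ.* a + (v ℕ.* M + z)) (m≡m%n+[m/n]*n w a)) (lemma (w % a) (w ℕ./ a) q a M z)
      where
      lemma : ∀ r p q a M z → q ℕ.* M ℕ.* a + ((r + p ℕ.* a) ℕ.* M + z) ≡ p ℕ.* M ℕ.* a + ((q ℕ.* a + r) ℕ.* M + z)
      lemma = solve-∀

-- Integers missing from `A`

∑-upper : ∀ n {f} → (∀ i → f i ≤ 1) → ∑ n f ≤ n
∑-upper zero    _   = z≤n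
∑-upper (suc n) f≤1 = +-mono-≤ (f≤1 0) (∑-upper n (f≤1 ∘ suc))

module _ {A : Pred ℕ 0ℓ} (A? : Decidable A) where

  missing : ℕ → ℕ
  missing x = if does (A? x) then 0 else 1

  missing≤1 : ∀ x → missing x ≤ 1
  missing≤1 x with does (A? x)
  ... | true  = z≤n
  ... | false = s≤s z≤n

  ∉⇒missing : ∀ {x} → x ∉ A → 0 < missing x
  ∉⇒missing {x} x∉A with A? x
  ... | yes x∈A = contradiction x∈A x∉A
  ... | no  _   = s≤s z≤n

  count+missing : ∀ n f → length (filter A? (applyUpTo f n)) + ∑ n (missing ∘ f) ≡ n
  count+missing zero    f = refl
  count+missing (suc n) f with does (A? (f 0))
  ... | true  = cong suc (count+missing n (f ∘ suc))
  ... | false = trans (+-suc _ _) (cong suc (count+missing n (f ∘ suc)))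

  count-upper : ∀ {n N w} → n < N → w ≤ ∑ N missing → ∣ A? ⟨ n ⟩∣ + w ≤ N
  count-upper {n} {N} {w} n<N w≤ = begin
    S + w                                            ≤⟨ +-monoʳ-≤ S w≤ ⟩
    S + ∑ N missing                                  ≡⟨ cong (λ l → S + ∑ l missing) N≡ ⟨
    S + ∑ (suc n + r) missing                        ≡⟨ cong (_+_ S) (∑-+ (suc n) r missing) ⟩
    S + (missing 0 + s + ∑ r (missing ∘ _+_ (suc n)))
      -- The terms at 0 and from `suc n` on lie outside the range of `S` and `s`; each is at most 1.
      ≤⟨ +-monoʳ-≤ S (+-mono-≤ (+-monoˡ-≤ s (missing≤1 0)) (∑-upper r (missing≤1 ∘ _+_ (suc n)))) ⟩
    S + (1 + s + r)                                  ≡⟨ regroup S s r ⟩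
    suc (S + s) + r                                  ≡⟨ cong (λ l → suc l + r) (count+missing n suc) ⟩
    suc n + r                                        ≡⟨ N≡ ⟩
    N                                                ∎
    where
    open ≤-Reasoning
    S = ∣ A? ⟨ n ⟩∣
    s = ∑ n (missing ∘ suc)
    r = N ∸ suc n
    N≡ : suc n + r ≡ N
    N≡ = m+[n∸m]≡n n<N
    regroup : ∀ S s r → S + (1 + s + r) ≡ suc (S + s) + r
    regroup = solve-∀

  missed⇒hit : ∀ {n} (f : ℕ → ℕ) q → All (_< n) q → ¬ All A (map f q) → Hit n (missing ∘ f) q
  missed⇒hit {n} f q q<n ¬all = go q<n (Anyₚ.map⁻ (Allₚ.¬All⇒Any¬ A? (map f q) ¬all))
    where
    go : ∀ {q} → All (_< n) q → Any (λ v → f v ∉ A) q → Hit n (missing ∘ f) q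
    go (v<n ∷ _)   (here fv∉A) = here (v<n , ∉⇒missing fv∉A)
    go (_   ∷ q<n) (there h)   = there (go q<n h)

  module _ {k M : ℕ} .{{_ : NonZero M}} (A∈C : A ∈ C k) where

    private
      pos : ℕ → ℕ → ℕ
      pos t j = t ℕ.* M + j

    -- A clique contained in `A` would supply `suc k` distinct pairwise coprime elements.
    block-hits : ∀ t → All (Hit M (missing ∘ pos t)) (blockCliques M (suc k))
    block-hits t = All.map
      (λ { {q} (len , edges , q<M) → missed⇒hit (pos t) q q<M λ q⊆A → proj₂ A∈C
        ( map (pos t) q
        , trans (length-map (pos t) q) len
        , AllPairsₚ.map⁺ (AllPairs.map (edge⇒≢ M t) edges)
        , q⊆A
        , AllPairsₚ.map⁺ (AllPairs.map (edge⇒coprime M t) edges)) })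
      (cliques-sound (edge? M) (suc k) (Allₚ.applyUpTo⁺₁ id M id))

    -- Here `a` itself completes a `k`-clique; `a < t ℕ.* M` makes it distinct from the elements of
    -- the block.
    nearby-hits : ∀ {a z} t → a ∈ A → Coprime a M → a ∣ pos t z → a < t ℕ.* M →
      All (Hit M (missing ∘ pos t)) (nearbyCliques M k z)
    nearby-hits {a} {z} t a∈A a⊥M a∣ a< = All.map
      (λ { {q} (len , edges , near) → missed⇒hit (pos t) q (All.map proj₂ near) λ q⊆A → proj₂ A∈C
        ( a ∷ map (pos t) q
        , cong suc (trans (length-map (pos t) q) len)
        , Allₚ.map⁺ (All.map (λ {j} _ → <⇒≢ (<-≤-trans a< (m≤m+n _ j))) near)
            ∷ AllPairsₚ.map⁺ (AllPairs.map (edge⇒≢ M t) edges)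
        , a∈A ∷ q⊆A
        , Allₚ.map⁺ (All.map (close⇒coprime M t a⊥M a∣ ∘ proj₁) near)
            ∷ AllPairsₚ.map⁺ (AllPairs.map (edge⇒coprime M t) edges)) })
      (cliques-sound (edge? M) k
        (All.zip (Allₚ.all-filter (close? M z) (upTo M) , Allₚ.filter⁺ (close? M z) (Allₚ.applyUpTo⁺₁ id M id))))

-- From a linear bound to the limit superior

limsup-bound : (u : ℕ → ℕ) (D P K : ℕ) .{{_ : NonZero D}} → (∀ n → u n ℕ.* D ≤ K + n ℕ.* P) →
  limsup (λ n → + u n / n) ≤ (+ P / D)
-- For r = R / e above P / D, integrality gives P e + 1 ≤ R D. Multiplied by `n`, the spare unit
-- absorbs the constant e K once `n` is at least that large.
limsup-bound u (suc d) P K bound (mkℚ r e-1 c) P/D<r = e ℕ.* K , below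
  where
  D e : ℕ
  D = suc d
  e = suc e-1
  P*e<r*D : + P * + e ℤ.< r * + D
  P*e<r*D = ℚᵘₚ.drop-*<* (ℚᵘₚ.<-respˡ-≃ (ℚₚ.toℚᵘ-fromℚᵘ (ℚᵘ.mkℚᵘ (+ P) d)) (ℚₚ.toℚᵘ-mono-< P/D<r))
  below : ∀ n .{{_ : NonZero n}} → e ℕ.* K ≤ n → + u n / n ℚ.≤ mkℚ r e-1 c
  below n@(suc n-1) eK≤n = ℚₚ.toℚᵘ-cancel-≤ (ℚᵘₚ.≤-respˡ-≃
    (ℚᵘₚ.≃-sym (ℚₚ.toℚᵘ-fromℚᵘ (ℚᵘ.mkℚᵘ (+ u n) n-1))) (ℚᵘ.*≤* (numerators r P*e<r*D)))
    where
    numerators : ∀ r → + P * + e ℤ.< r * + D → + u n * + e ℤ.≤ r * + n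
    numerators (ℤ.-[1+ _ ]) lt with () ← subst (ℤ._< _) (sym (ℤₚ.pos-* P e)) lt
    numerators (+ R) lt = subst₂ ℤ._≤_ (ℤₚ.pos-* (u n) e) (ℤₚ.pos-* R n) (ℤ.+≤+ (*-cancelʳ-≤ _ _ D (begin
      u n ℕ.* e ℕ.* D              ≡⟨ swap (u n) e D ⟩
      e ℕ.* (u n ℕ.* D)            ≤⟨ *-monoʳ-≤ e (bound n) ⟩
      e ℕ.* (K + n ℕ.* P)          ≡⟨ expand e K n P ⟩
      e ℕ.* K + n ℕ.* (P ℕ.* e)    ≤⟨ +-monoˡ-≤ _ eK≤n ⟩
      n + n ℕ.* (P ℕ.* e)          ≡⟨ *-suc n (P ℕ.* e) ⟨
      n ℕ.* suc (P ℕ.* e)          ≤⟨ *-monoʳ-≤ n (ℤₚ.drop‿+<+ (subst₂ ℤ._<_ (sym (ℤₚ.pos-* P e)) (sym (ℤₚ.pos-* R D)) lt)) ⟩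
      n ℕ.* (R ℕ.* D)              ≡⟨ rotate n R D ⟩
      R ℕ.* n ℕ.* D                ∎)))
      where
      open ≤-Reasoning
      swap : ∀ u e D → u ℕ.* e ℕ.* D ≡ e ℕ.* (u ℕ.* D)
      swap = solve-∀
      expand : ∀ e K n P → e ℕ.* (K + n ℕ.* P) ≡ e ℕ.* K + n ℕ.* (P ℕ.* e)
      expand = solve-∀
      rotate : ∀ n R D → n ℕ.* (R ℕ.* D) ≡ R ℕ.* n ℕ.* D
      rotate = solve-∀

-- Counting over periods of `a` blocks

module _ (k M m : ℕ) (zs : List ℕ) .{{_ : NonZero M}} (1<M : 1 < M)
  (block-needs  : T (needs m (blockCliques M (suc k))))
  (nearby-needs : All (λ z → T (needs (suc m) (nearbyCliques M k z ++ blockCliques M (suc k)))) zs)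
  where

  -- Every block misses `m` positions, and block `u z` one more. These blocks are distinct:
  -- multiples of `a` at offsets `y` and `z` of the same block would make `a` divide `∣ y - z ∣`.
  period-missing : ∀ {A a} (A? : Decidable A) .{{_ : NonZero a}} → A ∈ C k → a ∈ A → Coprime a M →
    AllPairs (λ y z → a ∤ ∣ y - z ∣) zs →
    ∀ p → a ℕ.* m + length zs ≤ ∑ (a ℕ.* M) (λ x → missing A? (a ℕ.* M + (p ℕ.* (a ℕ.* M) + x)))
  period-missing {A} {a} A? A∈C a∈A a⊥M separated p = begin
    a ℕ.* m + length zs     ≡⟨ cong (_+_ (a ℕ.* m)) (length-map u zs) ⟨
    a ℕ.* m + length us     ≤⟨ ∑-lower-strict g (λ v → needs-sound m _ block-needs (block-hits A? A∈C (t v))) us! more ⟩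
    ∑ a g                   ≡⟨ ∑-cong a (λ v → ∑-cong M λ j → cong (missing A?) (reindex p a v M j)) ⟩
    ∑ a (λ v → ∑ M (λ j → missing A? (L + (p ℕ.* L + (v ℕ.* M + j))))) ≡⟨ ∑-* a M _ ⟨
    ∑ L (λ x → missing A? (L + (p ℕ.* L + x))) ∎
    where
    open ≤-Reasoning
    L = a ℕ.* M
    -- Using `suc p` skips the first period, so that every block starts above `a`.
    t : ℕ → ℕ
    t v = suc p ℕ.* a + v
    g : ℕ → ℕ
    g v = ∑ M (λ j → missing A? (t v ℕ.* M + j))
    reindex : ∀ p a v M j → (suc p ℕ.* a + v) ℕ.* M + j ≡ a ℕ.* M + (p ℕ.* (a ℕ.* M) + (v ℕ.* M + j))
    reindex = solve-∀
    u : ℕ → ℕ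
    u z = proj₁ (divisible-block M a⊥M z)
    us = map u zs
    u< : ∀ z → u z < a
    u< z = proj₁ (proj₂ (divisible-block M a⊥M z))
    u∣ : ∀ z → a ∣ t (u z) ℕ.* M + z
    u∣ z = proj₂ (proj₂ (divisible-block M a⊥M z)) (suc p)
    us! : Unique us
    us! = AllPairsₚ.map⁺ (AllPairs.map (λ {y} {z} a∤ uy≡uz → a∤ (∣shifted⇒∣∣i-j∣ M (t (u z) ℕ.* M)
      (subst (λ v → a ∣ t v ℕ.* M + y) uy≡uz (u∣ y)) (u∣ z))) separated)
    a<tM : ∀ v → a < t v ℕ.* M
    a<tM v = begin-strict
      a              <⟨ m<m*n a M 1<M ⟩
      a ℕ.* M        ≤⟨ *-monoˡ-≤ M (≤-trans (m≤m+n a (p ℕ.* a)) (m≤m+n (suc p ℕ.* a) v)) ⟩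
      t v ℕ.* M      ∎
    more : All (λ v → v < a × m < g v) us
    more = Allₚ.map⁺ (All.map (λ {z} ok → u< z , needs-sound (suc m) _ ok
      (Allₚ.++⁺ (nearby-hits A? A∈C (t (u z)) a∈A a⊥M (u∣ z) (a<tM (u z))) (block-hits A? A∈C (t (u z))))) nearby-needs)

  -- With `c` = M - m, each period after the first holds at most c a - |zs| elements of `A`.
  density : ∀ {A a} c (A? : Decidable A) .{{_ : NonZero a}} .{{_ : NonZero (M ℕ.* a)}} →
    c + m ≡ M → length zs ≤ c ℕ.* a →
    A ∈ C k → a ∈ A → Coprime a M → AllPairs (λ y z → a ∤ ∣ y - z ∣) zs →
    upperDensity A? ≤ ((+ c * + a - + length zs) / (M ℕ.* a))
  density {A} {a} c A? c+m≡M e≤ca A∈C a∈A a⊥M separated =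
    subst (λ v → upperDensity A? ≤ (v / L)) (sym P≡) (limsup-bound (∣ A? ⟨_⟩∣) L P (L ℕ.* L) bound)
    where
    L = M ℕ.* a
    P = c ℕ.* a ∸ length zs
    w = a ℕ.* m + length zs
    P≡ : + c * + a - + length zs ≡ + P
    P≡ = trans (cong (_- + length zs) (sym (ℤₚ.pos-* c a))) (trans (ℤₚ.m-n≡m⊖n (c ℕ.* a) (length zs)) (ℤₚ.⊖-≥ e≤ca))
    P+w≡ : P + w ≡ L
    P+w≡ = begin
      P + (a ℕ.* m + length zs)    ≡⟨ cong (_+_ P) (+-comm (a ℕ.* m) (length zs)) ⟩
      P + (length zs + a ℕ.* m)    ≡⟨ +-assoc P (length zs) (a ℕ.* m) ⟨
      P + length zs + a ℕ.* m      ≡⟨ cong₂ _+_ (m∸n+n≡m e≤ca) (*-comm a m) ⟩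
      c ℕ.* a + m ℕ.* a            ≡⟨ *-distribʳ-+ a c m ⟨
      (c + m) ℕ.* a                ≡⟨ cong (ℕ._* a) c+m≡M ⟩
      L                            ∎
      where open ≡-Reasoning
    periods : ∀ Q → Q ℕ.* w ≤ ∑ (L + Q ℕ.* L) (missing A?)
    periods Q = begin
      Q ℕ.* w ≤⟨ ∑-lower Q (λ p → subst (λ l → w ≤ ∑ l (λ x → missing A? (l + (p ℕ.* l + x)))) (*-comm a M)
                   (period-missing A? A∈C a∈A a⊥M separated p)) ⟩
      ∑ Q (λ p → ∑ L (λ x → missing A? (L + (p ℕ.* L + x))))   ≡⟨ ∑-* Q L _ ⟨
      -- Nothing is claimed about the first period, whose blocks may contain `a`.
      ∑ (Q ℕ.* L) (missing A? ∘ _+_ L)                         ≤⟨ m≤n+m _ (∑ L (missing A?)) ⟩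
      ∑ L (missing A?) + ∑ (Q ℕ.* L) (missing A? ∘ _+_ L)      ≡⟨ ∑-+ L (Q ℕ.* L) (missing A?) ⟨
      ∑ (L + Q ℕ.* L) (missing A?)                             ∎
      where open ≤-Reasoning
    bound : ∀ n → ∣ A? ⟨ n ⟩∣ ℕ.* L ≤ L ℕ.* L + n ℕ.* P
    bound n = begin
      -- Cancelling Q w leaves S ≤ L + Q P: the first period is counted as full.
      S ℕ.* L                      ≤⟨ *-monoˡ-≤ L (+-cancelʳ-≤ (Q ℕ.* w) S (L + Q ℕ.* P) S+Qw≤) ⟩
      (L + Q ℕ.* P) ℕ.* L          ≡⟨ expand L Q P ⟩
      L ℕ.* L + Q ℕ.* L ℕ.* P      ≤⟨ +-monoʳ-≤ (L ℕ.* L) (*-monoˡ-≤ P (m/n*n≤m n L)) ⟩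
      L ℕ.* L + n ℕ.* P            ∎
      where
      open ≤-Reasoning
      S = ∣ A? ⟨ n ⟩∣
      Q = n ℕ./ L
      expand : ∀ L Q P → (L + Q ℕ.* P) ℕ.* L ≡ L ℕ.* L + Q ℕ.* L ℕ.* P
      expand = solve-∀
      collect : ∀ L Q P w → L + Q ℕ.* (P + w) ≡ L + Q ℕ.* P + Q ℕ.* w
      collect = solve-∀
      n<N : n < L + Q ℕ.* L
      n<N = subst (_< L + Q ℕ.* L) (sym (m≡m%n+[m/n]*n n L)) (+-monoˡ-< (Q ℕ.* L) (m%n<n n L))
      S+Qw≤ : S + Q ℕ.* w ≤ L + Q ℕ.* P + Q ℕ.* w
      S+Qw≤ = begin
        S + Q ℕ.* w                  ≤⟨ count-upper A? n<N (periods Q) ⟩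
        L + Q ℕ.* L                  ≡⟨ cong (λ l → L + Q ℕ.* l) P+w≡ ⟨
        L + Q ℕ.* (P + w)            ≡⟨ collect L Q P w ⟩
        L + Q ℕ.* P + Q ℕ.* w        ∎

-- Coprimality to the first primes, and the three bounds

nthPrime⇒coprime : ∀ {k i p a} .{{_ : NonZero a}} → 1 ≤ i → i ≤ k → IsNthPrime i p → a ∉ E k → Coprime a p
nthPrime⇒coprime {a = a} 1≤i i≤k nth@(p-prime , _) a∉E (d∣a , d∣p) with prime⇒irreducible p-prime d∣p
... | inj₁ d≡1  = d≡1
... | inj₂ refl = contradiction (ℕ.>-nonZero⁻¹ a , _ , _ , 1≤i , i≤k , nth , d∣a) a∉E

coprime-* : ∀ {a m n} → Coprime a m → Coprime a n → Coprime a (m ℕ.* n)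
coprime-* a⊥m a⊥n (d∣a , d∣mn) =
  a⊥n (d∣a , coprime-divisor (λ (e∣d , e∣m) → a⊥m (∣-trans e∣d d∣a , e∣m)) d∣mn)

-- A divisor of `M ^ 4` coprime to `M` is 1. If `a` were 1, a period would be a single block and
-- distinct offsets could not occupy distinct blocks.
separated : ∀ {a M} zs → a ≢ 1 → Coprime a M → AllPairs (Close M) zs → AllPairs (λ y z → a ∤ ∣ y - z ∣) zs
separated zs a≢1 a⊥M = AllPairs.map (λ close a∣ → a≢1 (coprime∧∣^⇒≡1 4 a⊥M (∣-trans a∣ close)))

corollary1 : (A : Pred ℕ 0ℓ) (A? : Decidable A) (a : ℕ) .{{_ : NonZero a}} →
    (A ∈ C 1 → a ∈ A ∖ E 1 →
    upperDensity A? ≤ ((+ a - + 1) / (2 ℕ.* a)) {{m*n≢0 2 a}})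
    × (A ∈ C 2 → a ∈ A ∖ E 2 → a ≢ 1 →
    upperDensity A? ≤ ((+ 4 * + a - + 2) / (6 ℕ.* a)) {{m*n≢0 6 a}})
    × (A ∈ C 3 → a ∈ A ∖ E 3 → a ≢ 1 →
    upperDensity A? ≤ ((+ 22 * + a - + 4) / (30 ℕ.* a)) {{m*n≢0 30 a}})
corollary1 A A? a = bound₁ , bound₂ , bound₃
  where
  instance
    _ = m*n≢0 2 a
    _ = m*n≢0 6 a
    _ = m*n≢0 30 a
  1≤a : 1 ≤ a
  1≤a = ℕ.>-nonZero⁻¹ a
  coprime₂ : ∀ {k} → 1 ≤ k → a ∉ E k → Coprime a 2
  coprime₂ 1≤k = nthPrime⇒coprime ≤-refl 1≤k (from-yes (prime? 2) , refl)
  coprime₃ : ∀ {k} → 2 ≤ k → a ∉ E k → Coprime a 3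
  coprime₃ 2≤k = nthPrime⇒coprime (s≤s z≤n) 2≤k (from-yes (prime? 3) , refl)
  coprime₅ : ∀ {k} → 3 ≤ k → a ∉ E k → Coprime a 5
  coprime₅ 3≤k = nthPrime⇒coprime (s≤s z≤n) 3≤k (from-yes (prime? 5) , refl)

  bound₁ : A ∈ C 1 → a ∈ A ∖ E 1 → upperDensity A? ≤ ((+ a - + 1) / (2 ℕ.* a))
  bound₁ A∈C (a∈A , a∉E) = subst (λ v → upperDensity A? ≤ ((v - + 1) / (2 ℕ.* a))) (ℤₚ.*-identityˡ (+ a))
    -- The offset 2 is the start of the next block; both 0 and 1 are close to it, so the whole block
    -- is missing. The certificates `_` hold by evaluating `needs`.
    (density 1 2 1 (2 ∷ []) (s≤s (s≤s z≤n)) _ (_ ∷ []) 1 A? refl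
      (≤-trans 1≤a (m≤n*m a 1)) A∈C a∈A (coprime₂ ≤-refl a∉E) ([] ∷ []))

  bound₂ : A ∈ C 2 → a ∈ A ∖ E 2 → a ≢ 1 → upperDensity A? ≤ ((+ 4 * + a - + 2) / (6 ℕ.* a))
  bound₂ A∈C (a∈A , a∉E) a≢1 = density 2 6 2 zs (s≤s (s≤s z≤n)) _ (_ ∷ _ ∷ []) 4 A? refl
    (≤-trans (s≤s (s≤s z≤n)) (*-monoʳ-≤ 4 1≤a)) A∈C a∈A a⊥6
    (separated zs a≢1 a⊥6 (from-yes (AllPairs.allPairs? (close? 6) zs)))
    where
    -- Close to 2, the positions 1, 3, 4, 5 are pairwise joined; close to 4, so are 1, 2, 3, 5. At
    -- most one of the four lies in `A`, so three are missing.
    zs = 2 ∷ 4 ∷ []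
    a⊥6 : Coprime a 6
    a⊥6 = coprime-* (coprime₂ (s≤s z≤n) a∉E) (coprime₃ ≤-refl a∉E)

  bound₃ : A ∈ C 3 → a ∈ A ∖ E 3 → a ≢ 1 → upperDensity A? ≤ ((+ 22 * + a - + 4) / (30 ℕ.* a))
  bound₃ A∈C (a∈A , a∉E) a≢1 = density 3 30 8 zs (s≤s (s≤s z≤n)) _ (_ ∷ _ ∷ _ ∷ _ ∷ []) 22 A? refl
    (≤-trans (m≤m+n 4 18) (*-monoʳ-≤ 22 1≤a)) A∈C a∈A a⊥30
    (separated zs a≢1 a⊥30 (from-yes (AllPairs.allPairs? (close? 30) zs)))
    where
    -- The differences 4, 8 and 12 divide `30 ^ 4`, so the four blocks are distinct; in each the
    -- search certifies nine missing positions.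
    zs = 9 ∷ 13 ∷ 17 ∷ 21 ∷ []
    a⊥30 : Coprime a 30
    a⊥30 = coprime-* (coprime₂ (s≤s z≤n) a∉E) (coprime-* (coprime₃ (s≤s (s≤s z≤n)) a∉E) (coprime₅ ≤-refl a∉E))
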